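{- Let $R$ be a commutative ring with unity and $m\ge1$ an integer. Let $\lambda_1,\mu_1:\mathbb N\times\mathbb Z\to R$ have triangular support of order $m$, with $\lambda_1(r,0),\mu_1(r,0)\in R^\times$ for $0\le r\le m-1$, and put $$f_n(x)=\sum_{b=0}^{w_m(n)}\lambda_1(n,b)\,x^{n-mb},\qquad g_n(x)=\sum_{c=0}^{w_m(n)}\mu_1(n,c)\,x^{n-mc}\qquad(n\in\mathbb N).$$ Assume that $\lambda_1$ and $\mu_1$ are lambda-recursive of order $m$ with parameters independent of $k$: there are $p^{(1)}_n,p^{(2)}_n\in R^\times$ and $h^{(1)}_n,h^{(2)}_n\in R$ ($n\ge m$) such that, for all $n\ge m$ and $0\le k\le w_m(n)$, $$\lambda_1(n,k)=p^{(1)}_n\lambda_1(n-1,k)-h^{(1)}_n\lambda_1(n-m,k-1),\qquad \mu_1(n,k)=p^{(2)}_n\mu_1(n-1,k)-h^{(2)}_n\mu_1(n-m,k-1),$$ while $\lambda_1(n,0)=c^{(1)}_n$ and $\mu_1(n,0)=c^{(2)}_n$ for $0\le n\le m-1$, where $c^{(i)}_n\in R$ are given initial data. For $(n,k)$ write $t=n-km$, $s=n-(k-1)m$, and define $$A_\mu(n,k)=\begin{cases}\dfrac1{p^{(2)}_t},&t\ge m,\\[6pt] \dfrac{\mu_1(t-1,0)}{\mu_1(t,0)},&1\le t<m,\\[6pt] 0,&t=0,\end{cases}\qquad A_\lambda(n,k)=\begin{cases}\dfrac1{p^{(1)}_t},&t\ge m,\\[6pt] \dfrac{\lambda_1(t-1,0)}{\lambda_1(t,0)},&1\le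 t<m,\\[6pt] 0,&t=0.\end{cases}$$ Direction $f\Rightarrow g$. Assume that there exists a family $\mu_3:\mathbb N\times\mathbb Z\to R$ with triangular support of order $m$ such that, for all $n\in\mathbb N$, $$x^n=\sum_{k=0}^{w_m(n)}\mu_3(n,k)\,g_{n-mk}(x),\qquad \mu_3(n,0)=\frac1{\mu_1(n,0)},$$ and, for $1\le k\le w_m(n)$, $$\mu_3(n,k)=A_\mu(n,k)\,\mu_3(n-1,k)+\frac{h^{(2)}_s}{p^{(2)}_s}\,\mu_3(n-1,k-1).$$ Define $z(n,k)=\sum_{b=0}^{k}\lambda_1(n,b)\,\mu_3(n-mb,k-b)$ for $0\le k\le w_m(n)$ and $z(n,k)=0$ for $k<0$ or $k>w_m(n)$. Then, for all $n\in\mathbb N$, $$f_n(x)=\sum_{k=0}^{w_m(n)}g_{n-mk}(x)\,z(n,k),\qquad z(n,0)=\frac{\lambda_1(n,0)}{\mu_1(n,0)},$$ and, for $1\le k\le w_m(n)$, $$z(n,k)=p^{(1)}_nA_\mu(n,k)\,z(n-1,k)+p^{(1)}_n\frac{h^{(2)}_s}{p^{(2)}_s}\,z(n-1,k-1)-h^{(1)}_n\,z(n-m,k-1).$$ Direction $g\Rightarrow f$. Symmetrically, assume that there exists a family $\lambda_3:\mathbb N\times\mathbb Z\to R$ with triangular support of order $m$ such that, for all $n\in\mathbb N$, $$x^n=\sum_{k=0}^{w_m(n)}\lambda_3(n,k)\,f_{n-mk}(x),\qquad \lambda_3(n,0)=\frac1{\lambda_1(n,0)},$$ and, for $1\le k\le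 w_m(n)$, $$\lambda_3(n,k)=A_\lambda(n,k)\,\lambda_3(n-1,k)+\frac{h^{(1)}_s}{p^{(1)}_s}\,\lambda_3(n-1,k-1).$$ Define $y(n,k)=\sum_{b=0}^{k}\mu_1(n,b)\,\lambda_3(n-mb,k-b)$ for $0\le k\le w_m(n)$ and $y(n,k)=0$ for $k<0$ or $k>w_m(n)$. Then, for all $n\in\mathbb N$, $$g_n(x)=\sum_{k=0}^{w_m(n)}f_{n-mk}(x)\,y(n,k),\qquad y(n,0)=\frac{\mu_1(n,0)}{\lambda_1(n,0)},$$ and, for $1\le k\le w_m(n)$, $$y(n,k)=p^{(2)}_nA_\lambda(n,k)\,y(n-1,k)+p^{(2)}_n\frac{h^{(1)}_s}{p^{(1)}_s}\,y(n-1,k-1)-h^{(2)}_n\,y(n-m,k-1).$$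
   Context: $\mathbb N=\{0,1,2,\dots\}$, $w_m(n)=\lfloor n/m\rfloor$, and $R^\times$ is the group of units of $R$. A family $\lambda:\mathbb N\times\mathbb Z\to R$ has triangular support of order $m$ (written $\lambda\in\Delta_m$) if $\lambda(n,k)=0$ whenever $k<0$ or $k>w_m(n)$. Under the stated assumptions, $\lambda_1(n,0)$ and $\mu_1(n,0)$ are units for all $n\ge0$, so all fractions are defined. -}

module Defs where

open import Algebra.Bundles using (CommutativeRing; RawMonoid)
open import Algebra.Definitions using (Invertible)
import Algebra.Definitions.RawMonoid as RawMonoidDefinitions
open import Data.Fin.Base using (toℕ)
open import Data.Integer.Base as ℤ using (ℤ; -[1+_])
open import Data.List.Base using (List; []; _∷_; _++_; map; replicate)
open import Data.Nat.Base using (ℕ; zero; suc; _∸_; _≤_; _<_; NonZero; z≤n)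
import Data.Nat.Base as ℕ
open import Data.Nat.DivMod using (m/n*n≤m)
import Data.Nat.Properties as ℕₚ
open import Data.Product.Base using (_,_; proj₁; proj₂)
open import Data.Sum.Base using (_⊎_; inj₁)
open import Level using (_⊔_)
open import Function.Base using (_∘_)
open import Relation.Binary.PropositionalEquality using (subst)
open import Relation.Nullary.Decidable using (yes; no)

module Units {a ℓ} (R : CommutativeRing a ℓ) where
  open CommutativeRing R hiding (zero)

  Unit : Carrier → Set _
  Unit = Invertible _≈_ 1# _*_

  infixl 7 _/_[_]

  _/_[_] : Carrier → (y : Carrier) → Unit y → Carrier
  x / _ [ y-unit ] = x * proj₁ y-unit

module Polynomials {a ℓ} (R : CommutativeRing a ℓ) where
  open CommutativeRing R hiding (zero)

  -- A polynomial is its list of coefficients, constant term first; trailing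
  -- zeros are allowed, so lists are compared coefficient by coefficient.
  Poly : Set a
  Poly = List Carrier

  coeff : Poly → ℕ → Carrier
  coeff []       _       = 0#
  coeff (x ∷ _)  zero    = x
  coeff (_ ∷ xs) (suc i) = coeff xs i

  infix 4 _≈ₚ_

  _≈ₚ_ : Poly → Poly → Set ℓ
  P ≈ₚ Q = ∀ i → coeff P i ≈ coeff Q i

  infixl 6 _+ₚ_
  infixl 7 _·_

  _+ₚ_ : Poly → Poly → Poly
  []       +ₚ ys       = ys
  (x ∷ xs) +ₚ []       = x ∷ xs
  (x ∷ xs) +ₚ (y ∷ ys) = (x + y) ∷ (xs +ₚ ys)

  _·_ : Carrier → Poly → Poly
  x · P = map (x *_) P

  X^_ : ℕ → Poly
  X^ n = replicate n 0# ++ (1# ∷ [])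

  +ₚ-rawMonoid : RawMonoid a ℓ
  +ₚ-rawMonoid = record { Carrier = Poly ; _≈_ = _≈ₚ_ ; _∙_ = _+ₚ_ ; ε = [] }

module Families {a ℓ} (R : CommutativeRing a ℓ) (m : ℕ) .{{_ : NonZero m}} where
  open CommutativeRing R hiding (zero)
  open Units R public
  open Polynomials R public

  infixl 10 ∑ ∑ₚ

  ∑ : ℕ → (ℕ → Carrier) → Carrier
  ∑ k u = RawMonoidDefinitions.sum +-rawMonoid {suc k} (u ∘ toℕ)

  ∑ₚ : ℕ → (ℕ → Poly) → Poly
  ∑ₚ k u = RawMonoidDefinitions.sum +ₚ-rawMonoid {suc k} (u ∘ toℕ)

  syntax ∑  k (λ i → e) = ∑[ i ≤ k ] e
  syntax ∑ₚ k (λ i → e) = ∑ₚ[ i ≤ k ] e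

  w : ℕ → ℕ
  w n = n ℕ./ m

  Family : Set a
  Family = ℕ → ℤ → Carrier

  TriangularSupport : Family → Set ℓ
  TriangularSupport α = ∀ n k → k ℤ.< ℤ.0ℤ ⊎ (ℤ.+ w n) ℤ.< k → α n k ≈ 0#

  poly : Family → ℕ → Poly
  poly α n = ∑ₚ[ b ≤ w n ] (α n (ℤ.+ b) · X^ (n ∸ m ℕ.* b))

  -- Truncated subtraction on indices is exact throughout: m * b ≤ n whenever
  -- b ≤ w n, and n ≥ m ≥ 1 in the recurrences.
  --
  -- p and h are constrained, and used, only at indices n ≥ m, and c only at
  -- indices n < m; the other values of these sequences are irrelevant.
  record LambdaRecursive (α : Family) : Set (a ⊔ ℓ) where
    field
      p h c      : ℕ → Carrier
      p-unit     : ∀ {n} → m ≤ n → Unit (p n)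
      recurrence : ∀ n k → m ≤ n → k ≤ w n →
                   α n (ℤ.+ k) ≈ p n * α (n ∸ 1) (ℤ.+ k) - h n * α (n ∸ m) (ℤ.+ k ℤ.- ℤ.1ℤ)
      initial    : ∀ n → n < m → α n ℤ.0ℤ ≈ c n

  open LambdaRecursive

  leading-unit : (α : Family) → TriangularSupport α →
                 (∀ r → r < m → Unit (α r ℤ.0ℤ)) →
                 LambdaRecursive α → ∀ n → Unit (α n ℤ.0ℤ)
  leading-unit α supp unit rec zero = unit zero (ℕₚ.n≢0⇒n>0 (ℕ.≢-nonZero⁻¹ m))
  leading-unit α supp unit rec (suc n) with m ℕₚ.≤? suc n
  ... | no  m≰n = unit (suc n) (ℕₚ.≰⇒> m≰n)
  ... | yes m≤n = i * j , trans (*-comm _ _) right , right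
    where
    open import Relation.Binary.Reasoning.Setoid setoid
    open import Algebra.Properties.Ring ring using (-0#≈0#)
    i = proj₁ (p-unit rec m≤n)
    j = proj₁ (leading-unit α supp unit rec n)
    P = p rec (suc n)
    y = α n ℤ.0ℤ

    α≈Py : α (suc n) ℤ.0ℤ ≈ P * y
    α≈Py = begin
      α (suc n) ℤ.0ℤ
        ≈⟨ recurrence rec (suc n) 0 m≤n z≤n ⟩
      P * y - h rec (suc n) * α (suc n ∸ m) -[1+ 0 ]
        ≈⟨ +-congˡ (-‿cong (*-congˡ (supp (suc n ∸ m) -[1+ 0 ] (inj₁ ℤ.-<+)))) ⟩
      P * y - h rec (suc n) * 0#
        ≈⟨ +-congˡ (trans (-‿cong (zeroʳ _)) -0#≈0#) ⟩
      P * y + 0#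
        ≈⟨ +-identityʳ _ ⟩
      P * y ∎

    right : α (suc n) ℤ.0ℤ * (i * j) ≈ 1#
    right = begin
      α (suc n) ℤ.0ℤ * (i * j)  ≈⟨ *-congʳ α≈Py ⟩
      (P * y) * (i * j)         ≈⟨ *-congˡ (*-comm i j) ⟩
      (P * y) * (j * i)         ≈⟨ *-assoc P y (j * i) ⟩
      P * (y * (j * i))         ≈⟨ *-congˡ (*-assoc y j i) ⟨
      P * ((y * j) * i)         ≈⟨ *-congˡ (*-congʳ (proj₂ (proj₂ (leading-unit α supp unit rec n)))) ⟩
      P * (1# * i)              ≈⟨ *-congˡ (*-identityˡ i) ⟩
      P * i                     ≈⟨ proj₂ (proj₂ (p-unit rec m≤n)) ⟩
      1# ∎

  module _ {α : Family} (rec : LambdaRecursive α) (unit : ∀ n → Unit (α n ℤ.0ℤ)) where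

    A-at : ℕ → Carrier
    A-at zero = 0#
    A-at (suc t) with m ℕₚ.≤? suc t
    ... | yes m≤t = 1# / p rec (suc t) [ p-unit rec m≤t ]
    ... | no  _   = α t ℤ.0ℤ / α (suc t) ℤ.0ℤ [ unit (suc t) ]

    A : ℕ → ℕ → Carrier
    A n k = A-at (n ∸ k ℕ.* m)

  m≤s : ∀ n k → 1 ≤ k → k ≤ w n → m ≤ n ∸ (k ∸ 1) ℕ.* m
  m≤s n (suc k) _ k<w = subst (_≤ n ∸ k ℕ.* m) (ℕₚ.m+n∸n≡m m (k ℕ.* m))
    (ℕₚ.∸-monoˡ-≤ (k ℕ.* m) (ℕₚ.≤-trans (ℕₚ.*-monoˡ-≤ m k<w) (m/n*n≤m n m)))

  -- h_s / p_s at s = n - (k-1)m.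
  h/p : {α : Family} → LambdaRecursive α → ∀ n k → 1 ≤ k → k ≤ w n → Carrier
  h/p rec n k 1≤k k≤w = h rec s / p rec s [ p-unit rec (m≤s n k 1≤k k≤w) ]
    where s = n ∸ (k ∸ 1) ℕ.* m

  convolution : Family → Family → Family
  convolution α β n -[1+ _ ] = 0#
  convolution α β n (ℤ.+ k) with k ℕₚ.≤? w n
  ... | yes _ = ∑[ b ≤ k ] (α n (ℤ.+ b) * β (n ∸ m ℕ.* b) (ℤ.+ k ℤ.- ℤ.+ b))
  ... | no  _ = 0#

-- Substitute the expansion of x^(n-mb) in the g's into f_n and collect the terms
-- with b + j = k: this gives f_n = Σ_k z(n,k) g_{n-mk}.  For the recurrence of z,
-- apply the recurrence of λ₁ to each λ₁(n,b).  The coefficients A and h/p depend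
-- on (n,k) only through n - km, hence are the same at (n - mb, k - b), so the
-- recurrence of μ₃ can be applied under the sum with common coefficients.  Only
-- the term b = k is not covered by that recurrence; there
-- μ₃(t,0) = A μ₃(t-1,0) for t = n - km ≥ 1, while λ₁(n-1,k) = 0 if t = 0.

module Submission where

open import Defs
open import Algebra.Bundles using (CommutativeRing)
open import Data.Fin.Base using (toℕ)
open import Data.Fin.Properties using (toℕ≤pred[n])
open import Data.Integer.Base as ℤ using (+_; -[1+_]; 0ℤ; 1ℤ)
import Data.Integer.Properties as ℤₚ
open import Data.List.Base using ([]; _∷_)
open import Data.Nat.Base as ℕ using (ℕ; zero; suc; NonZero; _≤_; _<_; _∸_; z≤n; s≤s)
open import Data.Nat.DivMod using (m/n*n≤m; m*n/n≡m; /-monoˡ-≤; m<n*o⇒m/o<n; [m∸n]/n≡m/n∸1; [m∸n*o]/o≡m/o∸n)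
import Data.Nat.Properties as ℕₚ
open import Data.Product.Base using (_×_; _,_; proj₁; proj₂)
open import Data.Sum.Base using (inj₁; inj₂)
open import Function.Base using (_∘_)
open import Relation.Binary.PropositionalEquality as ≡ using (_≡_)
open import Relation.Nullary.Decidable using (yes; no)
open import Relation.Nullary.Negation using (contradiction)

-- Index arithmetic with truncated subtraction

n∸m*b∸[k∸b]*m≡n∸k*m : ∀ n {b k} → b ≤ k → ∀ m → n ∸ m ℕ.* b ∸ (k ∸ b) ℕ.* m ≡ n ∸ k ℕ.* m
n∸m*b∸[k∸b]*m≡n∸k*m n {b} {k} b≤k m = begin
  n ∸ m ℕ.* b ∸ (k ∸ b) ℕ.* m      ≡⟨ ℕₚ.∸-+-assoc n (m ℕ.* b) _ ⟩
  n ∸ (m ℕ.* b ℕ.+ (k ∸ b) ℕ.* m)  ≡⟨ ≡.cong (λ e → n ∸ (e ℕ.+ (k ∸ b) ℕ.* m)) (ℕₚ.*-comm m b) ⟩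
  n ∸ (b ℕ.* m ℕ.+ (k ∸ b) ℕ.* m)  ≡⟨ ≡.cong (n ∸_) (ℕₚ.*-distribʳ-+ m b (k ∸ b)) ⟨
  n ∸ (b ℕ.+ (k ∸ b)) ℕ.* m        ≡⟨ ≡.cong (λ e → n ∸ e ℕ.* m) (ℕₚ.m+[n∸m]≡n b≤k) ⟩
  n ∸ k ℕ.* m                      ∎
  where open ≡.≡-Reasoning

∸-+-*-assoc : ∀ n m b j → n ∸ m ℕ.* b ∸ m ℕ.* j ≡ n ∸ m ℕ.* (b ℕ.+ j)
∸-+-*-assoc n m b j = ≡.trans (ℕₚ.∸-+-assoc n (m ℕ.* b) (m ℕ.* j))
                              (≡.cong (n ∸_) (≡.sym (ℕₚ.*-distribˡ-+ m b j)))

∸-swap : ∀ n i j → n ∸ i ∸ j ≡ n ∸ j ∸ i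
∸-swap n i j = ≡.trans (ℕₚ.∸-+-assoc n i j)
  (≡.trans (≡.cong (n ∸_) (ℕₚ.+-comm i j)) (≡.sym (ℕₚ.∸-+-assoc n j i)))

+m-+n≡+[m∸n] : ∀ {m n} → n ≤ m → + m ℤ.- + n ≡ + (m ∸ n)
+m-+n≡+[m∸n] {m} {n} n≤m = ≡.trans (ℤₚ.[+m]-[+n]≡m⊖n m n) (ℤₚ.⊖-≥ n≤m)

-- Coefficients of sums and scalar multiples of polynomials

module _ {r ℓ} (R : CommutativeRing r ℓ) where
  open CommutativeRing R hiding (zero)
  open Polynomials R

  coeff-+ₚ : ∀ P Q i → coeff (P +ₚ Q) i ≈ coeff P i + coeff Q i
  coeff-+ₚ []      Q       i       = sym (+-identityˡ _)
  coeff-+ₚ (_ ∷ _) []      i       = sym (+-identityʳ _)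
  coeff-+ₚ (_ ∷ _) (_ ∷ _) zero    = refl
  coeff-+ₚ (_ ∷ P) (_ ∷ Q) (suc i) = coeff-+ₚ P Q i

  coeff-· : ∀ x P i → coeff (x · P) i ≈ x * coeff P i
  coeff-· x []      i       = sym (zeroʳ x)
  coeff-· x (_ ∷ _) zero    = refl
  coeff-· x (_ ∷ P) (suc i) = coeff-· x P i

module _ {r ℓ} (R : CommutativeRing r ℓ) (m : ℕ) .{{_ : NonZero m}} where
  open CommutativeRing R hiding (zero)
  open Families R m
  open LambdaRecursive
  open import Algebra.Properties.Ring ring using (-0#≈0#; -‿distribˡ-*)
  open import Algebra.Properties.Semiring.Sum semiring
    using (sum-cong-≋; ∑-distrib-+; *-distribˡ-sum; *-distribʳ-sum)
  open import Algebra.Solver.Ring.NaturalCoefficients.Default commutativeSemiring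
    using (solve; _:*_; _:+_; _:=_)
  open import Relation.Binary.Reasoning.Setoid setoid

  -- Finite sums in the ring and coefficients of polynomial sums

  ∑-cong : ∀ k {u v : ℕ → Carrier} → (∀ i → i ≤ k → u i ≈ v i) → ∑ k u ≈ ∑ k v
  ∑-cong k u≈v = sum-cong-≋ {suc k} (λ i → u≈v (toℕ i) (toℕ≤pred[n] i))

  ∑-+ : ∀ k (u v : ℕ → Carrier) → ∑[ i ≤ k ] (u i + v i) ≈ ∑ k u + ∑ k v
  ∑-+ k u v = ∑-distrib-+ {suc k} (u ∘ toℕ) (v ∘ toℕ)

  *-∑ : ∀ k x (u : ℕ → Carrier) → x * ∑ k u ≈ ∑[ i ≤ k ] (x * u i)
  *-∑ k x u = *-distribˡ-sum {suc k} x (u ∘ toℕ)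

  ∑-* : ∀ k (u : ℕ → Carrier) x → ∑ k u * x ≈ ∑[ i ≤ k ] (u i * x)
  ∑-* k u x = *-distribʳ-sum {suc k} x (u ∘ toℕ)

  ∑-last : ∀ k (u : ℕ → Carrier) → ∑ (suc k) u ≈ ∑ k u + u (suc k)
  ∑-last zero    u = sym (trans (+-assoc _ _ _) (+-congˡ (+-comm _ _)))
  ∑-last (suc k) u = trans (+-congˡ (∑-last k (u ∘ suc))) (sym (+-assoc _ _ _))

  -- Induction on `N`, splitting off the row `b = 0`: the other rows form a triangle of size `N`,
  -- and the entries of the row `b = 0` become the first summands of the antidiagonals `b + j = k`.
  ∑-triangle : ∀ N (F : ℕ → ℕ → Carrier) →
               ∑[ b ≤ N ] (∑[ j ≤ N ∸ b ] F b j) ≈ ∑[ k ≤ N ] (∑[ b ≤ k ] F b (k ∸ b))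
  ∑-triangle zero    F = refl
  ∑-triangle (suc N) F = begin
    ∑ (suc N) (F 0) + ∑[ b ≤ N ] (∑[ j ≤ N ∸ b ] F (suc b) j)
      ≈⟨ +-congˡ (∑-triangle N (F ∘ suc)) ⟩
    F 0 0 + ∑ N (F 0 ∘ suc) + ∑[ k ≤ N ] (∑[ b ≤ k ] F (suc b) (k ∸ b))
      ≈⟨ +-assoc _ _ _ ⟩
    F 0 0 + (∑ N (F 0 ∘ suc) + ∑[ k ≤ N ] (∑[ b ≤ k ] F (suc b) (k ∸ b)))
      -- `F 0 0 + 0#` is the unfolded one-term sum for the antidiagonal `k = 0`.
      ≈⟨ +-cong (+-identityʳ _) (∑-+ N (F 0 ∘ suc) (λ k → ∑[ b ≤ k ] F (suc b) (k ∸ b))) ⟨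
    F 0 0 + 0# + ∑[ k ≤ N ] (F 0 (suc k) + ∑[ b ≤ k ] F (suc b) (k ∸ b)) ∎

  coeff-∑ₚ : ∀ k (u : ℕ → Poly) i → coeff (∑ₚ k u) i ≈ ∑[ j ≤ k ] coeff (u j) i
  coeff-∑ₚ zero    u i = coeff-+ₚ R (u 0) [] i
  coeff-∑ₚ (suc k) u i = trans (coeff-+ₚ R (u 0) (∑ₚ k (u ∘ suc)) i) (+-congˡ (coeff-∑ₚ k (u ∘ suc) i))

  coeff-∑ₚ-· : ∀ k (x : ℕ → Carrier) (P : ℕ → Poly) i →
               coeff (∑ₚ[ j ≤ k ] (x j · P j)) i ≈ ∑[ j ≤ k ] (x j * coeff (P j) i)
  coeff-∑ₚ-· k x P i = trans (coeff-∑ₚ k (λ j → x j · P j) i) (∑-cong k (λ j _ → coeff-· R (x j) (P j) i))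

  -- Bounds on `w` and the boundary of the support triangle

  w[n∸m*b] : ∀ n b → w (n ∸ m ℕ.* b) ≡ w n ∸ b
  w[n∸m*b] n b = ≡.trans (≡.cong (λ e → w (n ∸ e)) (ℕₚ.*-comm m b)) ([m∸n*o]/o≡m/o∸n n b m)

  k≤w⇒k*m≤n : ∀ {n k} → k ≤ w n → k ℕ.* m ≤ n
  k≤w⇒k*m≤n {n} k≤w = ℕₚ.≤-trans (ℕₚ.*-monoˡ-≤ m k≤w) (m/n*n≤m n m)

  k*m≤n⇒k≤w : ∀ {n k} → k ℕ.* m ≤ n → k ≤ w n
  k*m≤n⇒k≤w {n} {k} km≤n = ≡.subst (_≤ w n) (m*n/n≡m k m) (/-monoˡ-≤ m km≤n)

  k<w⇒m≤n : ∀ {n k} → suc k ≤ w n → m ≤ n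
  k<w⇒m≤n {n} {k} k<w = ℕₚ.≤-trans (ℕₚ.m≤m+n m (k ℕ.* m)) (k≤w⇒k*m≤n k<w)

  0<m : 0 < m
  0<m = ℕₚ.n≢0⇒n>0 (ℕ.≢-nonZero⁻¹ m)

  k≤w[n∸m] : ∀ {n k} → suc k ≤ w n → k ≤ w (n ∸ m)
  k≤w[n∸m] {n} k<w = ≡.subst (_ ≤_) (≡.sym ([m∸n]/n≡m/n∸1 n m)) (ℕₚ.pred-mono-≤ k<w)

  k≤w[n∸1] : ∀ {n k} → suc k ≤ w n → k ≤ w (n ∸ 1)
  k≤w[n∸1] {n} k<w = ℕₚ.≤-trans (k≤w[n∸m] k<w) (/-monoˡ-≤ m (ℕₚ.∸-monoʳ-≤ n 0<m))

  -- Together with `zero-remainder` this decides, by the remainder `n ∸ k * m`, whether `(n ∸ 1, k)`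
  -- lies in the triangle. A positive remainder means `k * m ≤ n ∸ 1`.
  positive-remainder : ∀ {n k t} → n ∸ k ℕ.* m ≡ suc t → k ≤ w (n ∸ 1)
  positive-remainder eq =
    k*m≤n⇒k≤w (ℕₚ.pred-mono-≤ (ℕₚ.m∸n≢0⇒n<m (λ eq₀ → contradiction (≡.trans (≡.sym eq₀) eq) λ ())))

  zero-remainder : ∀ {n k} → 0 < n → n ∸ k ℕ.* m ≡ 0 → w (n ∸ 1) < k
  zero-remainder {suc n} _ eq = m<n*o⇒m/o<n (ℕₚ.m∸n≡0⇒m≤n eq)

  -- Normal forms for `h/p` and `convolution`

  h/p-cong : {α : Family} (rec : LambdaRecursive α) → ∀ {s s′} → s ≡ s′ →
             (m≤s : m ≤ s) (m≤s′ : m ≤ s′) →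
             h rec s / p rec s [ p-unit rec m≤s ] ≡ h rec s′ / p rec s′ [ p-unit rec m≤s′ ]
  -- The inverse of `p` is selected by a proof of `m ≤ s`; any two such proofs are equal.
  h/p-cong rec {s} ≡.refl m≤s m≤s′ =
    ≡.cong (λ m≤s → h rec s / p rec s [ p-unit rec m≤s ]) (ℕₚ.≤-irrelevant m≤s m≤s′)

  -- The index `s` is unchanged when `(n, k + 1)` moves to `(n - mb, k + 1 - b)`. The bound `b ≤ k`
  -- keeps the second coordinate positive, so that its predecessor is `k - b`.
  h/p-shift : {α : Family} (rec : LambdaRecursive α) → ∀ n {k b} → b ≤ k →
              ∀ 1≤j j≤w 1≤k k≤w →
              h/p rec (n ∸ m ℕ.* b) (suc k ∸ b) 1≤j j≤w ≡ h/p rec n (suc k) 1≤k k≤w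
  h/p-shift rec n {k} {b} b≤k 1≤j j≤w 1≤k k≤w = h/p-cong rec
    (≡.trans (≡.cong (λ e → n ∸ m ℕ.* b ∸ e ℕ.* m) (∸-swap (suc k) b 1)) (n∸m*b∸[k∸b]*m≡n∸k*m n b≤k m))
    (m≤s (n ∸ m ℕ.* b) (suc k ∸ b) 1≤j j≤w) (m≤s n (suc k) 1≤k k≤w)

  -- Inside the triangle the support test disappears, and `b ≤ k` turns the integer difference into
  -- a natural number.
  convolution-≤ : ∀ α β {n k} → k ≤ w n →
                  convolution α β n (+ k) ≈ ∑[ b ≤ k ] (α n (+ b) * β (n ∸ m ℕ.* b) (+ (k ∸ b)))
  convolution-≤ α β {n} {k} k≤w with k ℕₚ.≤? w n
  ... | no  k≰w = contradiction k≤w k≰w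
  ... | yes _   = ∑-cong k λ b b≤k →
    reflexive (≡.cong (λ j → α n (+ b) * β (n ∸ m ℕ.* b) j) (+m-+n≡+[m∸n] b≤k))

  -- Recurrence of the leading coefficients and of their inverses

  recurrence-zero : {α : Family} → TriangularSupport α → (rec : LambdaRecursive α) →
                    ∀ {n} → m ≤ n → α n 0ℤ ≈ p rec n * α (n ∸ 1) 0ℤ
  recurrence-zero {α} supp rec {n} m≤n = begin
    α n 0ℤ
      ≈⟨ recurrence rec n 0 m≤n z≤n ⟩
    p rec n * α (n ∸ 1) 0ℤ - h rec n * α (n ∸ m) -[1+ 0 ]
      ≈⟨ +-congˡ (-‿cong (*-congˡ (supp (n ∸ m) -[1+ 0 ] (inj₁ ℤ.-<+)))) ⟩
    p rec n * α (n ∸ 1) 0ℤ - h rec n * 0#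
      ≈⟨ +-congˡ (trans (-‿cong (zeroʳ _)) -0#≈0#) ⟩
    p rec n * α (n ∸ 1) 0ℤ + 0#
      ≈⟨ +-identityʳ _ ⟩
    p rec n * α (n ∸ 1) 0ℤ ∎

  -- For `t + 1 < m` the factor `A` is the quotient of consecutive leading coefficients, so the
  -- product telescopes. For `t + 1 ≥ m` the recurrence gives `ν(t+1,0) = p ν(t,0)`, which is then
  -- inverted.
  A-at-leading : {ν : Family} → TriangularSupport ν →
                 (rec : LambdaRecursive ν) (unit : ∀ n → Unit (ν n 0ℤ)) →
                 ∀ t → proj₁ (unit (suc t)) ≈ A-at rec unit (suc t) * proj₁ (unit t)
  A-at-leading {ν} supp rec unit t with m ℕₚ.≤? suc t
  ... | no _ = begin
    i′            ≈⟨ *-identityʳ i′ ⟨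
    i′ * 1#       ≈⟨ *-congˡ (proj₂ (proj₂ (unit t))) ⟨
    i′ * (u * i)  ≈⟨ solve 3 (λ i′ u i → i′ :* (u :* i) := u :* i′ :* i) refl i′ u i ⟩
    u * i′ * i    ∎
    where
    u  = ν t 0ℤ
    i  = proj₁ (unit t)
    i′ = proj₁ (unit (suc t))
  ... | yes m≤t = begin
    i′                          ≈⟨ *-identityʳ i′ ⟨
    i′ * 1#                     ≈⟨ *-congˡ (*-identityʳ 1#) ⟨
    -- The two units become `P * q` and `u * i`, so that `P * u` can be regrouped as `ν (suc t) 0ℤ`
    -- and cancelled against `i′`.
    i′ * (1# * 1#)              ≈⟨ *-congˡ (*-cong (proj₂ (proj₂ (p-unit rec m≤t))) (proj₂ (proj₂ (unit t)))) ⟨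
    i′ * (P * q * (u * i))      ≈⟨ solve 5 (λ i′ P q u i →
                                     i′ :* (P :* q :* (u :* i)) := i′ :* (P :* u) :* (q :* i))
                                     refl i′ P q u i ⟩
    i′ * (P * u) * (q * i)      ≈⟨ *-congʳ (*-congˡ (recurrence-zero supp rec m≤t)) ⟨
    i′ * ν (suc t) 0ℤ * (q * i) ≈⟨ *-congʳ (proj₁ (proj₂ (unit (suc t)))) ⟩
    1# * (q * i)                ≈⟨ *-assoc 1# q i ⟨
    1# * q * i                  ∎
    where
    P  = p rec (suc t)
    q  = proj₁ (p-unit rec m≤t)
    u  = ν t 0ℤ
    i  = proj₁ (unit t)
    i′ = proj₁ (unit (suc t))

  -- Expansion of the polynomials of `α` in those of `ν`, with `β` expanding the powers of `x`

  module _ (α ν β : Family) where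

    private
      z = convolution α β

    convolution-zero : (ν-unit : ∀ n → Unit (ν n 0ℤ)) →
                       (∀ n → β n 0ℤ ≈ 1# / ν n 0ℤ [ ν-unit n ]) →
                       ∀ n → z n 0ℤ ≈ α n 0ℤ / ν n 0ℤ [ ν-unit n ]
    convolution-zero ν-unit β-leading n = begin
      z n 0ℤ                                ≈⟨ convolution-≤ α β z≤n ⟩
      α n 0ℤ * β (n ∸ m ℕ.* 0) 0ℤ + 0#      ≈⟨ +-identityʳ _ ⟩
      α n 0ℤ * β (n ∸ m ℕ.* 0) 0ℤ           ≡⟨ ≡.cong (λ e → α n 0ℤ * β (n ∸ e) 0ℤ) (ℕₚ.*-zeroʳ m) ⟩
      α n 0ℤ * β n 0ℤ                       ≈⟨ *-congˡ (β-leading n) ⟩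
      α n 0ℤ * (1# * proj₁ (ν-unit n))      ≈⟨ *-congˡ (*-identityˡ _) ⟩
      α n 0ℤ * proj₁ (ν-unit n)             ∎

    convolution-expansion :
      (∀ n → X^ n ≈ₚ ∑ₚ[ k ≤ w n ] (β n (+ k) · poly ν (n ∸ m ℕ.* k))) →
      ∀ n → poly α n ≈ₚ ∑ₚ[ k ≤ w n ] (z n (+ k) · poly ν (n ∸ m ℕ.* k))
    convolution-expansion expansion n i = begin
      coeff (poly α n) i
        ≈⟨ coeff-∑ₚ-· N (λ b → α n (+ b)) (λ b → X^ (n ∸ m ℕ.* b)) i ⟩
      ∑[ b ≤ N ] (α n (+ b) * coeff (X^ (n ∸ m ℕ.* b)) i)
        ≈⟨ ∑-cong N (λ b _ → expand b) ⟩
      ∑[ b ≤ N ] (∑[ j ≤ N ∸ b ] F b j)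
        ≈⟨ ∑-triangle N F ⟩
      ∑[ k ≤ N ] (∑[ b ≤ k ] F b (k ∸ b))
        ≈⟨ ∑-cong N collect ⟨
      ∑[ k ≤ N ] (z n (+ k) * G k)
        ≈⟨ coeff-∑ₚ-· N (λ k → z n (+ k)) (λ k → poly ν (n ∸ m ℕ.* k)) i ⟨
      coeff (∑ₚ[ k ≤ N ] (z n (+ k) · poly ν (n ∸ m ℕ.* k))) i ∎
      where
      N = w n

      G : ℕ → Carrier
      G k = coeff (poly ν (n ∸ m ℕ.* k)) i

      -- Since `(n - mb) - mj = n - m(b + j)`, the polynomial in the term `(b, j)` depends only on
      -- `b + j`.
      F : ℕ → ℕ → Carrier
      F b j = α n (+ b) * (β (n ∸ m ℕ.* b) (+ j) * G (b ℕ.+ j))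

      expand : ∀ b → α n (+ b) * coeff (X^ (n ∸ m ℕ.* b)) i ≈ ∑[ j ≤ N ∸ b ] F b j
      expand b = begin
        α n (+ b) * coeff (X^ n′) i
          ≈⟨ *-congˡ (expansion n′ i) ⟩
        α n (+ b) * coeff (∑ₚ[ j ≤ w n′ ] (β n′ (+ j) · poly ν (n′ ∸ m ℕ.* j))) i
          ≈⟨ *-congˡ (coeff-∑ₚ-· (w n′) (λ j → β n′ (+ j)) (λ j → poly ν (n′ ∸ m ℕ.* j)) i) ⟩
        α n (+ b) * ∑[ j ≤ w n′ ] (β n′ (+ j) * coeff (poly ν (n′ ∸ m ℕ.* j)) i)
          ≈⟨ *-∑ (w n′) (α n (+ b)) (λ j → β n′ (+ j) * coeff (poly ν (n′ ∸ m ℕ.* j)) i) ⟩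
        ∑[ j ≤ w n′ ] (α n (+ b) * (β n′ (+ j) * coeff (poly ν (n′ ∸ m ℕ.* j)) i))
          ≈⟨ ∑-cong (w n′) (λ j _ → reflexive (≡.cong
               (λ e → α n (+ b) * (β n′ (+ j) * coeff (poly ν e) i)) (∸-+-*-assoc n m b j))) ⟩
        ∑ (w n′) (F b)
          -- The inner sum has upper limit `w n ∸ b`, which makes the domain of summation a
          -- triangle.
          ≡⟨ ≡.cong (λ e → ∑ e (F b)) (w[n∸m*b] n b) ⟩
        ∑ (N ∸ b) (F b) ∎
        where n′ = n ∸ m ℕ.* b

      collect : ∀ k → k ≤ N → z n (+ k) * G k ≈ ∑[ b ≤ k ] F b (k ∸ b)
      collect k k≤w = begin
        z n (+ k) * G k
          ≈⟨ *-congʳ (convolution-≤ α β k≤w) ⟩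
        (∑[ b ≤ k ] (α n (+ b) * β (n ∸ m ℕ.* b) (+ (k ∸ b)))) * G k
          ≈⟨ ∑-* k (λ b → α n (+ b) * β (n ∸ m ℕ.* b) (+ (k ∸ b))) (G k) ⟩
        ∑[ b ≤ k ] (α n (+ b) * β (n ∸ m ℕ.* b) (+ (k ∸ b)) * G k)
          ≈⟨ ∑-cong k (λ b b≤k → trans (*-assoc (α n (+ b)) (β (n ∸ m ℕ.* b) (+ (k ∸ b))) (G k))
               (reflexive (≡.cong (λ e → α n (+ b) * (β (n ∸ m ℕ.* b) (+ (k ∸ b)) * G e))
                                  (≡.sym (ℕₚ.m+[n∸m]≡n b≤k))))) ⟩
        ∑[ b ≤ k ] F b (k ∸ b) ∎

    -- The recurrence of the convolution

    module _ (α-supp : TriangularSupport α) (ν-supp : TriangularSupport ν) (β-supp : TriangularSupport β)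
             (α-rec : LambdaRecursive α) (ν-rec : LambdaRecursive ν)
             (ν-unit : ∀ n → Unit (ν n 0ℤ))
             (β-leading : ∀ n → β n 0ℤ ≈ 1# / ν n 0ℤ [ ν-unit n ])
             (β-rec : ∀ n k (1≤k : 1 ≤ k) (k≤w : k ≤ w n) →
                β n (+ k) ≈ A ν-rec ν-unit n k * β (n ∸ 1) (+ k)
                            + h/p ν-rec n k 1≤k k≤w * β (n ∸ 1) (+ k ℤ.- 1ℤ)) where

      -- This is the column `k = 0`, where `β-rec` does not apply.
      β-leading-step : ∀ t → β (suc t) 0ℤ ≈ A-at ν-rec ν-unit (suc t) * β t 0ℤ
      β-leading-step t = begin
        β (suc t) 0ℤ                                        ≈⟨ β-leading (suc t) ⟩
        1# * proj₁ (ν-unit (suc t))                         ≈⟨ *-identityˡ _ ⟩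
        proj₁ (ν-unit (suc t))                              ≈⟨ A-at-leading ν-supp ν-rec ν-unit t ⟩
        A-at ν-rec ν-unit (suc t) * proj₁ (ν-unit t)        ≈⟨ *-congˡ (*-identityˡ _) ⟨
        A-at ν-rec ν-unit (suc t) * (1# * proj₁ (ν-unit t)) ≈⟨ *-congˡ (β-leading t) ⟨
        A-at ν-rec ν-unit (suc t) * β t 0ℤ                  ∎

      diagonal-term : ∀ n k → 0 < n → ∀ t → n ∸ k ℕ.* m ≡ t →
                      α (n ∸ 1) (+ k) * β t 0ℤ
                      ≈ A-at ν-rec ν-unit t * (α (n ∸ 1) (+ k) * β (t ∸ 1) 0ℤ)
      -- Both sides vanish: the left one since `(n ∸ 1, k)` is outside the support of `α`, the right
      -- one since `A-at` is `0#` at `0`. Here `t ∸ 1` is the truncated value `0`.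
      diagonal-term n k 0<n zero    eq = begin
        α (n ∸ 1) (+ k) * β 0 0ℤ         ≈⟨ *-congʳ (α-supp (n ∸ 1) (+ k) (inj₂ (ℤ.+<+ (zero-remainder 0<n eq)))) ⟩
        0# * β 0 0ℤ                      ≈⟨ zeroˡ _ ⟩
        0#                               ≈⟨ zeroˡ _ ⟨
        0# * (α (n ∸ 1) (+ k) * β 0 0ℤ)  ∎
      diagonal-term n k _   (suc t) eq = begin
        x * β (suc t) 0ℤ                           ≈⟨ *-congˡ (β-leading-step t) ⟩
        x * (A-at ν-rec ν-unit (suc t) * β t 0ℤ)   ≈⟨ solve 3 (λ x a b → x :* (a :* b) := a :* (x :* b)) refl x _ _ ⟩
        A-at ν-rec ν-unit (suc t) * (x * β t 0ℤ)   ∎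
        where x = α (n ∸ 1) (+ k)

      module _ (n k : ℕ) (1≤k : 1 ≤ suc k) (k<w : suc k ≤ w n) where

        private
          a q P H : Carrier
          a = A ν-rec ν-unit n (suc k)
          q = h/p ν-rec n (suc k) 1≤k k<w
          P = p α-rec n
          H = h α-rec n

          -- Their sums over `b ≤ k + 1` yield `z(n-1, k+1)` (after multiplication by `a`),
          -- `z(n-1, k)` and `z(n-m, k)`.
          F G E : ℕ → Carrier
          F b = α (n ∸ 1) (+ b) * β (n ∸ 1 ∸ m ℕ.* b) (+ (suc k ∸ b))
          G b = α (n ∸ 1) (+ b) * β (n ∸ 1 ∸ m ℕ.* b) (+ (suc k ∸ b) ℤ.- 1ℤ)
          E b = α (n ∸ m) (+ b ℤ.- 1ℤ) * β (n ∸ m ℕ.* b) (+ (suc k ∸ b))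

        off-diagonal-term : ∀ b → b ≤ k →
          α (n ∸ 1) (+ b) * β (n ∸ m ℕ.* b) (+ (suc k ∸ b)) ≈ a * F b + q * G b
        off-diagonal-term b b≤k = begin
          x * β n′ (+ j)
            ≈⟨ *-congˡ (β-rec n′ j 1≤j j≤w) ⟩
          x * (A ν-rec ν-unit n′ j * β (n′ ∸ 1) (+ j) + h/p ν-rec n′ j 1≤j j≤w * β (n′ ∸ 1) (+ j ℤ.- 1ℤ))
            ≡⟨ ≡.cong₂ (λ a q → x * (a * β (n′ ∸ 1) (+ j) + q * β (n′ ∸ 1) (+ j ℤ.- 1ℤ)))
                 (≡.cong (A-at ν-rec ν-unit) (n∸m*b∸[k∸b]*m≡n∸k*m n (ℕₚ.m≤n⇒m≤1+n b≤k) m))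
                 (h/p-shift ν-rec n b≤k 1≤j j≤w 1≤k k<w) ⟩
          x * (a * β (n′ ∸ 1) (+ j) + q * β (n′ ∸ 1) (+ j ℤ.- 1ℤ))
            ≡⟨ ≡.cong (λ e → x * (a * β e (+ j) + q * β e (+ j ℤ.- 1ℤ))) (∸-swap n (m ℕ.* b) 1) ⟩
          x * (a * β n″ (+ j) + q * β n″ (+ j ℤ.- 1ℤ))
            ≈⟨ solve 5 (λ x a y q y′ → x :* (a :* y :+ q :* y′) := a :* (x :* y) :+ q :* (x :* y′))
                 refl x a _ q _ ⟩
          a * F b + q * G b ∎
          where
          x  = α (n ∸ 1) (+ b)
          n′ = n ∸ m ℕ.* b
          n″ = n ∸ 1 ∸ m ℕ.* b
          j  = suc k ∸ b
          1≤j : 1 ≤ j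
          1≤j = ℕₚ.m<n⇒0<n∸m (s≤s b≤k)
          j≤w : j ≤ w n′
          j≤w = ≡.subst (j ≤_) (≡.sym (w[n∸m*b] n b)) (ℕₚ.∸-monoˡ-≤ b k<w)

        -- The second index of `β` is `-1`, outside its support. Hence a `G` term can be added at
        -- `b = k + 1` for free.
        G-last : G (suc k) ≈ 0#
        G-last = begin
          G (suc k)               ≡⟨ ≡.cong (λ j → x * β n″ (+ j ℤ.- 1ℤ)) (ℕₚ.n∸n≡0 k) ⟩
          x * β n″ -[1+ 0 ]       ≈⟨ *-congˡ (β-supp n″ -[1+ 0 ] (inj₁ ℤ.-<+)) ⟩
          x * 0#                  ≈⟨ zeroʳ x ⟩
          0#                      ∎
          where
          x  = α (n ∸ 1) (+ suc k)
          n″ = n ∸ 1 ∸ m ℕ.* suc k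

        -- Puts the diagonal term `b = k + 1` in the same form as the others, so that `a` and `q`
        -- can be taken out of the whole sum.
        product-term : ∀ b → b ≤ suc k →
          α (n ∸ 1) (+ b) * β (n ∸ m ℕ.* b) (+ (suc k ∸ b)) ≈ a * F b + q * G b
        product-term b b≤1+k with ℕₚ.m≤n⇒m<n∨m≡n b≤1+k
        ... | inj₁ (s≤s b≤k) = off-diagonal-term b b≤k
        ... | inj₂ ≡.refl = begin
          x * β (n ∸ m ℕ.* suc k) (+ (k ∸ k))
            ≡⟨ ≡.cong₂ (λ e j → x * β (n ∸ e) (+ j)) (ℕₚ.*-comm m (suc k)) (ℕₚ.n∸n≡0 k) ⟩
          x * β (n ∸ suc k ℕ.* m) 0ℤ
            ≈⟨ diagonal-term n (suc k) (ℕₚ.≤-trans 0<m (k<w⇒m≤n k<w)) _ ≡.refl ⟩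
          a * (x * β (n ∸ suc k ℕ.* m ∸ 1) 0ℤ)
            ≡⟨ ≡.cong (λ e → a * (x * β e 0ℤ)) (∸-swap n (suc k ℕ.* m) 1) ⟩
          a * (x * β (n ∸ 1 ∸ suc k ℕ.* m) 0ℤ)
            ≡⟨ ≡.cong₂ (λ e j → a * (x * β (n ∸ 1 ∸ e) (+ j))) (ℕₚ.*-comm m (suc k)) (ℕₚ.n∸n≡0 k) ⟨
          a * F (suc k)
            ≈⟨ +-identityʳ _ ⟨
          a * F (suc k) + 0#
            ≈⟨ +-congˡ (trans (*-congˡ G-last) (zeroʳ q)) ⟨
          a * F (suc k) + q * G (suc k) ∎
          where x = α (n ∸ 1) (+ suc k)

        z-term : ∀ b → b ≤ suc k →
          α n (+ b) * β (n ∸ m ℕ.* b) (+ (suc k ∸ b)) ≈ P * a * F b + P * q * G b + (- H) * E b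
        z-term b b≤1+k = begin
          α n (+ b) * y
            ≈⟨ *-congʳ (recurrence α-rec n b (k<w⇒m≤n k<w) (ℕₚ.≤-trans b≤1+k k<w)) ⟩
          -- The subtraction becomes addition of `(- H) * x′`, so that semiring identities and
          -- linearity of sums apply with `- H` as a coefficient.
          (P * x - H * x′) * y
            ≈⟨ *-congʳ (+-congˡ (-‿distribˡ-* H x′)) ⟩
          (P * x + (- H) * x′) * y
            ≈⟨ solve 5 (λ P x H x′ y → (P :* x :+ H :* x′) :* y := P :* (x :* y) :+ H :* (x′ :* y))
                 refl P x (- H) x′ y ⟩
          P * (x * y) + (- H) * E b
            ≈⟨ +-congʳ (*-congˡ (product-term b b≤1+k)) ⟩
          P * (a * F b + q * G b) + (- H) * E b
            ≈⟨ +-congʳ (solve 5 (λ P a u q v → P :* (a :* u :+ q :* v) := P :* a :* u :+ P :* q :* v)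
                 refl P a (F b) q (G b)) ⟩
          P * a * F b + P * q * G b + (- H) * E b ∎
          where
          x  = α (n ∸ 1) (+ b)
          x′ = α (n ∸ m) (+ b ℤ.- 1ℤ)
          y  = β (n ∸ m ℕ.* b) (+ (suc k ∸ b))

        -- The sum is identified with `z` only under the factor `A`: at remainder `0` the pair
        -- `(n ∸ 1, k + 1)` is outside the triangle, but `A` is zero there.
        A*∑F : ∀ t → n ∸ suc k ℕ.* m ≡ t →
               A-at ν-rec ν-unit t * ∑ (suc k) F ≈ A-at ν-rec ν-unit t * z (n ∸ 1) (+ suc k)
        A*∑F zero    _  = trans (zeroˡ _) (sym (zeroˡ _))
        A*∑F (suc t) eq = *-congˡ (sym (convolution-≤ α β (positive-remainder eq)))

        ∑G : ∑ (suc k) G ≈ z (n ∸ 1) (+ k)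
        ∑G = begin
          ∑ (suc k) G      ≈⟨ ∑-last k G ⟩
          ∑ k G + G (suc k) ≈⟨ trans (+-congˡ G-last) (+-identityʳ _) ⟩
          -- For `b ≤ k` the index is a successor, so subtracting `1ℤ` computes to `+ (k ∸ b)`.
          ∑ k G            ≈⟨ ∑-cong k (λ b b≤k → reflexive (≡.cong
                                (λ j → α (n ∸ 1) (+ b) * β (n ∸ 1 ∸ m ℕ.* b) (+ j ℤ.- 1ℤ))
                                (ℕₚ.+-∸-assoc 1 b≤k))) ⟩
          ∑[ b ≤ k ] (α (n ∸ 1) (+ b) * β (n ∸ 1 ∸ m ℕ.* b) (+ (k ∸ b)))
                           ≈⟨ convolution-≤ α β (k≤w[n∸1] k<w) ⟨
          z (n ∸ 1) (+ k)  ∎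

        -- The term `b = 0` has `α` at index `-1` and vanishes; the others are reindexed by
        -- `n - m(b + 1) = (n - m) - mb`.
        ∑E : ∑ (suc k) E ≈ z (n ∸ m) (+ k)
        ∑E = begin
          E 0 + ∑[ b ≤ k ] E (suc b)
            ≈⟨ +-congʳ (trans (*-congʳ (α-supp (n ∸ m) -[1+ 0 ] (inj₁ ℤ.-<+))) (zeroˡ _)) ⟩
          0# + ∑[ b ≤ k ] E (suc b)
            ≈⟨ +-identityˡ _ ⟩
          ∑[ b ≤ k ] (α (n ∸ m) (+ b) * β (n ∸ m ℕ.* suc b) (+ (k ∸ b)))
            ≈⟨ ∑-cong k (λ b _ → reflexive (≡.cong (λ e → α (n ∸ m) (+ b) * β e (+ (k ∸ b)))
                 (≡.trans (≡.cong (n ∸_) (ℕₚ.*-suc m b)) (≡.sym (ℕₚ.∸-+-assoc n m (m ℕ.* b)))))) ⟩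
          ∑[ b ≤ k ] (α (n ∸ m) (+ b) * β (n ∸ m ∸ m ℕ.* b) (+ (k ∸ b)))
            ≈⟨ convolution-≤ α β (k≤w[n∸m] k<w) ⟨
          z (n ∸ m) (+ k) ∎

        convolution-recurrence-suc :
          z n (+ suc k) ≈ P * a * z (n ∸ 1) (+ suc k) + P * q * z (n ∸ 1) (+ k) - H * z (n ∸ m) (+ k)
        convolution-recurrence-suc = begin
          z n (+ suc k)
            ≈⟨ convolution-≤ α β k<w ⟩
          ∑[ b ≤ suc k ] (α n (+ b) * β (n ∸ m ℕ.* b) (+ (suc k ∸ b)))
            ≈⟨ ∑-cong (suc k) z-term ⟩
          ∑[ b ≤ suc k ] (P * a * F b + P * q * G b + (- H) * E b)
            ≈⟨ ∑-+ (suc k) (λ b → P * a * F b + P * q * G b) (λ b → (- H) * E b) ⟩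
          ∑[ b ≤ suc k ] (P * a * F b + P * q * G b) + ∑[ b ≤ suc k ] ((- H) * E b)
            ≈⟨ +-congʳ (∑-+ (suc k) (λ b → P * a * F b) (λ b → P * q * G b)) ⟩
          ∑[ b ≤ suc k ] (P * a * F b) + ∑[ b ≤ suc k ] (P * q * G b) + ∑[ b ≤ suc k ] ((- H) * E b)
            ≈⟨ +-cong (+-cong (*-∑ (suc k) (P * a) F) (*-∑ (suc k) (P * q) G)) (*-∑ (suc k) (- H) E) ⟨
          P * a * ∑ (suc k) F + P * q * ∑ (suc k) G + (- H) * ∑ (suc k) E
            ≈⟨ +-cong (+-cong (trans (*-assoc P a _) (trans (*-congˡ (A*∑F _ ≡.refl)) (sym (*-assoc P a _))))
                              (*-congˡ ∑G))
                      (trans (*-congˡ ∑E) (sym (-‿distribˡ-* H _))) ⟩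
          P * a * z (n ∸ 1) (+ suc k) + P * q * z (n ∸ 1) (+ k) - H * z (n ∸ m) (+ k) ∎

      convolution-recurrence : ∀ n k (1≤k : 1 ≤ k) (k≤w : k ≤ w n) →
        z n (+ k) ≈ p α-rec n * A ν-rec ν-unit n k * z (n ∸ 1) (+ k)
                    + p α-rec n * h/p ν-rec n k 1≤k k≤w * z (n ∸ 1) (+ k ℤ.- 1ℤ)
                    - h α-rec n * z (n ∸ m) (+ k ℤ.- 1ℤ)
      -- `+ suc k ℤ.- 1ℤ` computes to `+ k`.
      convolution-recurrence n (suc k) = convolution-recurrence-suc n k

-- The two directions as instances of the convolution results

theorem4p2 : ∀ {a ℓ} (R : CommutativeRing a ℓ) (m : ℕ) .{{_ : NonZero m}} →
  let open CommutativeRing R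
      open Families R m
      open LambdaRecursive
  in
  (λ₁ μ₁ : Family)
  (λ₁-supp : TriangularSupport λ₁) (μ₁-supp : TriangularSupport μ₁)
  (λ₁-init : ∀ r → r < m → Unit (λ₁ r 0ℤ)) (μ₁-init : ∀ r → r < m → Unit (μ₁ r 0ℤ))
  (λ₁-rec : LambdaRecursive λ₁) (μ₁-rec : LambdaRecursive μ₁) →
  let f = poly λ₁
      g = poly μ₁
      λ₁-unit = leading-unit λ₁ λ₁-supp λ₁-init λ₁-rec
      μ₁-unit = leading-unit μ₁ μ₁-supp μ₁-init μ₁-rec
      A-λ = A λ₁-rec λ₁-unit
      A-μ = A μ₁-rec μ₁-unit
  in
  ( (μ₃ : Family) → TriangularSupport μ₃ →
    (∀ n → X^ n ≈ₚ ∑ₚ[ k ≤ w n ] (μ₃ n (+ k) · g (n ∸ m ℕ.* k))) →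
    (∀ n → μ₃ n 0ℤ ≈ 1# / μ₁ n 0ℤ [ μ₁-unit n ]) →
    (∀ n k (1≤k : 1 ≤ k) (k≤w : k ≤ w n) →
      μ₃ n (+ k) ≈ A-μ n k * μ₃ (n ∸ 1) (+ k)
                   + h/p μ₁-rec n k 1≤k k≤w * μ₃ (n ∸ 1) (+ k ℤ.- 1ℤ)) →
    let z = convolution λ₁ μ₃ in
    (∀ n → f n ≈ₚ ∑ₚ[ k ≤ w n ] (z n (+ k) · g (n ∸ m ℕ.* k)))
    × (∀ n → z n 0ℤ ≈ λ₁ n 0ℤ / μ₁ n 0ℤ [ μ₁-unit n ])
    × (∀ n k (1≤k : 1 ≤ k) (k≤w : k ≤ w n) →
        z n (+ k) ≈ p λ₁-rec n * A-μ n k * z (n ∸ 1) (+ k)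
                    + p λ₁-rec n * h/p μ₁-rec n k 1≤k k≤w * z (n ∸ 1) (+ k ℤ.- 1ℤ)
                    - h λ₁-rec n * z (n ∸ m) (+ k ℤ.- 1ℤ)) )
  ×
  ( (λ₃ : Family) → TriangularSupport λ₃ →
    (∀ n → X^ n ≈ₚ ∑ₚ[ k ≤ w n ] (λ₃ n (+ k) · f (n ∸ m ℕ.* k))) →
    (∀ n → λ₃ n 0ℤ ≈ 1# / λ₁ n 0ℤ [ λ₁-unit n ]) →
    (∀ n k (1≤k : 1 ≤ k) (k≤w : k ≤ w n) →
      λ₃ n (+ k) ≈ A-λ n k * λ₃ (n ∸ 1) (+ k)
                   + h/p λ₁-rec n k 1≤k k≤w * λ₃ (n ∸ 1) (+ k ℤ.- 1ℤ)) →
    let y = convolution μ₁ λ₃ in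
    (∀ n → g n ≈ₚ ∑ₚ[ k ≤ w n ] (y n (+ k) · f (n ∸ m ℕ.* k)))
    × (∀ n → y n 0ℤ ≈ μ₁ n 0ℤ / λ₁ n 0ℤ [ λ₁-unit n ])
    × (∀ n k (1≤k : 1 ≤ k) (k≤w : k ≤ w n) →
        y n (+ k) ≈ p μ₁-rec n * A-λ n k * y (n ∸ 1) (+ k)
                    + p μ₁-rec n * h/p λ₁-rec n k 1≤k k≤w * y (n ∸ 1) (+ k ℤ.- 1ℤ)
                    - h μ₁-rec n * y (n ∸ m) (+ k ℤ.- 1ℤ)) )
theorem4p2 R m λ₁ μ₁ λ₁-supp μ₁-supp λ₁-init μ₁-init λ₁-rec μ₁-rec =
  (λ μ₃ μ₃-supp expansion μ₃-leading μ₃-rec →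
    convolution-expansion R m λ₁ μ₁ μ₃ expansion ,
    convolution-zero R m λ₁ μ₁ μ₃ μ₁-unit μ₃-leading ,
    convolution-recurrence R m λ₁ μ₁ μ₃ λ₁-supp μ₁-supp μ₃-supp λ₁-rec μ₁-rec μ₁-unit μ₃-leading μ₃-rec) ,
  -- The same three results with the roles of `λ₁` and `μ₁` exchanged and `λ₃` in place of `μ₃`.
  (λ λ₃ λ₃-supp expansion λ₃-leading λ₃-rec →
    convolution-expansion R m μ₁ λ₁ λ₃ expansion ,
    convolution-zero R m μ₁ λ₁ λ₃ λ₁-unit λ₃-leading ,
    convolution-recurrence R m μ₁ λ₁ λ₃ μ₁-supp λ₁-supp λ₃-supp μ₁-rec λ₁-rec λ₁-unit λ₃-leading λ₃-rec)
  where
  open Families R m using (leading-unit)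
  λ₁-unit = leading-unit λ₁ λ₁-supp λ₁-init λ₁-rec
  μ₁-unit = leading-unit μ₁ μ₁-supp μ₁-init μ₁-rec
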